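{- Let $G$ be a finite additive abelian group, $\Sigma=(\Gamma,\sigma)$ a signed graph with underlying graph $\Gamma=(V,E)$, and $\omega$ an orientation compatible with $\sigma$. Define $\delta:G^V\to G^E$ by $(\delta g)(e)=\omega(v,e)g(v)+\omega(u,e)g(u)$ for each edge $e$ with half-edges $(u,e),(v,e)$. Then $\delta$ is a group homomorphism (under pointwise addition), its image is contained in the group of $G$-tensions of $\Sigma$, and $$\ker\delta\cong G^{k_b(\Sigma)}\times G_2^{k_u(\Sigma)},$$ where $G_2=\{x\in G:2x=0\}$.
   Context: A signed graph $\Sigma=(\Gamma,\sigma)$: finite graph $\Gamma=(V,E)$ (loops, multiple edges allowed), $\sigma:E\to\{ -1,1\}$. A cycle (loops included) is balanced if the product of its edge signs is $1$, unbalanced otherwise. $k_b$, $k_u$: numbers of connected components with all cycles balanced, resp. containing an unbalanced cycle. Each edge $e$ with endpoints $u,v$ has half-edges $(u,e),(v,e)$ (a loop at $v$ has two half-edges at $v$); an orientation $\omega$ assigns $\pm1$ to each half-edge, compatible with $\sigma$ if $\sigma(e)=-\omega(u,e)\omega(v,e)$. A walk $(v_1,e_1,\dots,v_k,e_k,v_{k+1})$ has $e_i$ joining $v_i,v_{i+1}$; $\omega(v_i,e_i)$ is the orientation of the half-edge of $e_i$ at $v_i$ by which the walk leaves $v_i$. Circuits of $\Sigma$: edge sets of balanced cycles, of unbalanced tight handcuffs (two unbalanced cycles sharing exactly one vertex) and of unbalanced loose handcuffs (two vertex-disjoint unbalanced cycles joined by a path meeting them only at its endpoints, whose edges are circuit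 path edges). A circuit walk is a closed walk traversing a circuit using circuit path edges twice and other edges once. $f:E\to G$ is a $G$-tension if for every circuit walk $(v_1,e_1,\dots,v_k,e_k,v_1)$, $\sum_{i=1}^k\big(\omega(v_i,e_i)\prod_{j<i}\sigma(e_j)\big)f(e_i)=0$. -}

module Defs where

open import Level using (Level; _⊔_) renaming (zero to lzero)
open import Data.Bool using (Bool; true; false; not)
open import Data.Nat using (ℕ; zero; suc; _+_; _*_; _≥_)
open import Data.Fin using (Fin; _≟_) renaming (_≤_ to _≤ᶠ_)
open import Data.Sign using (Sign; opposite) renaming (_*_ to _·_)
open import Data.List using (List; []; _∷_; _++_; [_]; length; filter)
open import Data.List.Membership.Propositional using (_∈_; _∉_)
open import Data.List.Relation.Unary.Unique.Propositional using (Unique)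
open import Data.Product using (Σ; ∃; ∃-syntax; _×_; _,_; proj₁; proj₂)
open import Relation.Binary.PropositionalEquality using (_≡_)
open import Relation.Nullary using (¬_)
open import Algebra.Bundles using (AbelianGroup)
open import Function.Definitions using (Injective)

------------------------------------------------------------------------
-- Signed graphs.  Vertices are Fin nV, edges are Fin nE.  Each edge e
-- has two half-edges, (end e false , e) and (end e true , e); a loop is
-- an edge with end e false ≡ end e true.  Multiple edges are allowed.

record SignedGraph : Set where
  field
    nV nE : ℕ
    end   : Fin nE → Bool → Fin nV
    σ     : Fin nE → Sign

module _ (Γ : SignedGraph) where
  open SignedGraph Γ

  -- orientation: ω e b is the value on the half-edge (end e b , e)
  Orientation : Set
  Orientation = Fin nE → Bool → Sign

  -- σ(e) = - ω(u,e) ω(v,e)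
  Compatible : Orientation → Set
  Compatible ω = ∀ e → σ e ≡ opposite (ω e false · ω e true)

  -- Walks from u to w.  A step (e , b) leaves the current vertex
  -- end e b by the half-edge (end e b , e) and arrives at end e (not b).
  data Walk : Fin nV → Fin nV → Set where
    []   : ∀ {v} → Walk v v
    step : ∀ {u w} (e : Fin nE) (b : Bool) → end e b ≡ u →
           Walk (end e (not b)) w → Walk u w

  edges : ∀ {u w} → Walk u w → List (Fin nE)
  edges []                = []
  edges (step e b _ rest) = e ∷ edges rest

  -- v₁ , … , v_k  (the vertex each step leaves from)
  verts : ∀ {u w} → Walk u w → List (Fin nV)
  verts []                        = []
  verts (step {u = u} e b _ rest) = u ∷ verts rest

  -- v₁ , … , v_{k+1}
  allVerts : ∀ {u w} → Walk u w → List (Fin nV)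
  allVerts {w = w} p = verts p ++ [ w ]

  signW : ∀ {u w} → Walk u w → Sign
  signW []                = Sign.+
  signW (step e b _ rest) = σ e · signW rest

  Balanced : ∀ {u w} → Walk u w → Set
  Balanced c = signW c ≡ Sign.+

  Unbalanced : ∀ {u w} → Walk u w → Set
  Unbalanced c = ¬ Balanced c

  -- a cycle (loops included): a nonempty closed walk with no repeated
  -- edge and no repeated vertex
  IsCycle : ∀ {u} → Walk u u → Set
  IsCycle c = (length (edges c) ≥ 1) × Unique (edges c) × Unique (verts c)

  -- a path: a walk with no repeated vertex
  IsPath : ∀ {u w} → Walk u w → Set
  IsPath p = Unique (allVerts p)

  -- number of occurrences of an edge in a list
  occ : Fin nE → List (Fin nE) → ℕ
  occ e es = length (filter (e ≟_) es)

  -- Circuits, each recorded by the multiplicity with which a circuit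
  -- walk must traverse each edge (2 on circuit path edges, 1 on the
  -- other circuit edges, 0 outside the circuit).
  data CircuitMult : (Fin nE → ℕ) → Set where
    balancedCycle : ∀ {u} (c : Walk u u) → IsCycle c → Balanced c →
      CircuitMult (λ e → occ e (edges c))
    tightHandcuff : ∀ {u v} (c₁ : Walk u u) (c₂ : Walk v v) →
      IsCycle c₁ → IsCycle c₂ → Unbalanced c₁ → Unbalanced c₂ →
      (∃[ x ] (x ∈ verts c₁ × x ∈ verts c₂ ×
               (∀ y → y ∈ verts c₁ → y ∈ verts c₂ → y ≡ x))) →
      (∀ e → e ∈ edges c₁ → e ∉ edges c₂) →
      CircuitMult (λ e → occ e (edges c₁) + occ e (edges c₂))
    looseHandcuff : ∀ {u v x y} (c₁ : Walk u u) (c₂ : Walk v v)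
      (p : Walk x y) →
      IsCycle c₁ → IsCycle c₂ → Unbalanced c₁ → Unbalanced c₂ →
      (∀ z → z ∈ verts c₁ → z ∉ verts c₂) →
      IsPath p → x ∈ verts c₁ → y ∈ verts c₂ →
      (∀ z → z ∈ allVerts p → z ∈ verts c₁ → z ≡ x) →
      (∀ z → z ∈ allVerts p → z ∈ verts c₂ → z ≡ y) →
      CircuitMult (λ e → occ e (edges c₁) + occ e (edges c₂)
                         + 2 * occ e (edges p))

  -- circuit walk: a closed walk traversing a circuit, using circuit
  -- path edges twice and the other circuit edges once
  IsCircuitWalk : ∀ {u} → Walk u u → Set
  IsCircuitWalk w =
    ∃[ m ] (CircuitMult m × (∀ e → occ e (edges w) ≡ m e))

  -- connected components: a component is represented by its least vertex
  IsRep : Fin nV → Set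
  IsRep v = ∀ u → Walk v u → v ≤ᶠ u

  -- all cycles of the component of v are balanced
  BalancedComp : Fin nV → Set
  BalancedComp v = ∀ u (c : Walk u u) → Walk v u → IsCycle c → Balanced c

  -- the component of v contains an unbalanced cycle
  UnbalancedComp : Fin nV → Set
  UnbalancedComp v =
    ∃[ u ] Σ (Walk u u) (λ c → Walk v u × IsCycle c × Unbalanced c)

  -- P (a predicate on vertices) holds for exactly k vertices
  HasCount : (Fin nV → Set) → ℕ → Set
  HasCount P k = Σ (Fin k → Fin nV) λ f →
    Injective _≡_ _≡_ f × (∀ i → P (f i)) × (∀ v → P v → ∃[ i ] f i ≡ v)

  -- k_b(Σ) = k and k_u(Σ) = k
  IsKb : ℕ → Set
  IsKb = HasCount (λ v → IsRep v × BalancedComp v)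

  IsKu : ℕ → Set
  IsKu = HasCount (λ v → IsRep v × UnbalancedComp v)

  module _ {c ℓ} (G : AbelianGroup c ℓ) where
    open AbelianGroup G

    -- action of ±1 on G
    act : Sign → Carrier → Carrier
    act Sign.+ x = x
    act Sign.- x = x ⁻¹

    -- Σ_i (ω(v_i,e_i) Π_{j<i} σ(e_j)) f(e_i), with accumulated sign s
    tsum : Orientation → (Fin nE → Carrier) → Sign → ∀ {u w} → Walk u w → Carrier
    tsum ω f s []                = ε
    tsum ω f s (step e b _ rest) =
      act (ω e b · s) (f e) ∙ tsum ω f (s · σ e) rest

    IsTension : Orientation → (Fin nE → Carrier) → Set ℓ
    IsTension ω f = ∀ {u} (w : Walk u u) → IsCircuitWalk w →
                    tsum ω f Sign.+ w ≈ ε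

    -- (δ g)(e) = ω(v,e) g(v) + ω(u,e) g(u)
    δ : Orientation → (Fin nV → Carrier) → Fin nE → Carrier
    δ ω g e = act (ω e true) (g (end e true)) ∙ act (ω e false) (g (end e false))

    -- δ is a homomorphism G^V → G^E (pointwise operations)
    IsHomδ : Orientation → Set (c ⊔ ℓ)
    IsHomδ ω = ∀ (g h : Fin nV → Carrier) e →
               δ ω (λ v → g v ∙ h v) e ≈ δ ω g e ∙ δ ω h e

    -- ker δ ⊆ G^V, with pointwise equality
    Ker : Orientation → Set (c ⊔ ℓ)
    Ker ω = Σ (Fin nV → Carrier) λ g → ∀ e → δ ω g e ≈ ε

    -- G^{kb} × G₂^{ku},  G₂ = {x : 2x = 0}
    Target : ℕ → ℕ → Set (c ⊔ ℓ)
    Target kb ku = (Fin kb → Carrier) ×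
                   Σ (Fin ku → Carrier) (λ b → ∀ j → b j ∙ b j ≈ ε)

    -- A group isomorphism ker δ ≅ G^{kb} × G₂^{ku}: mutually inverse
    -- (up to ≈) well-defined maps, the forward one additive.
    record KerIso (ω : Orientation) (kb ku : ℕ) : Set (c ⊔ ℓ) where
      field
        to   : Ker ω → Target kb ku
        from : Target kb ku → Ker ω
        to-cong : ∀ x y → (∀ v → proj₁ x v ≈ proj₁ y v) →
          (∀ i → proj₁ (to x) i ≈ proj₁ (to y) i) ×
          (∀ j → proj₁ (proj₂ (to x)) j ≈ proj₁ (proj₂ (to y)) j)
        from-cong : ∀ s t → (∀ i → proj₁ s i ≈ proj₁ t i) →
          (∀ j → proj₁ (proj₂ s) j ≈ proj₁ (proj₂ t) j) →
          ∀ v → proj₁ (from s) v ≈ proj₁ (from t) v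
        -- additivity: if z = x + y in ker δ then to z = to x + to y
        to-hom : ∀ x y z → (∀ v → proj₁ z v ≈ proj₁ x v ∙ proj₁ y v) →
          (∀ i → proj₁ (to z) i ≈ proj₁ (to x) i ∙ proj₁ (to y) i) ×
          (∀ j → proj₁ (proj₂ (to z)) j ≈
                 proj₁ (proj₂ (to x)) j ∙ proj₁ (proj₂ (to y)) j)
        to-from : ∀ s →
          (∀ i → proj₁ (to (from s)) i ≈ proj₁ s i) ×
          (∀ j → proj₁ (proj₂ (to (from s))) j ≈ proj₁ (proj₂ s) j)
        from-to : ∀ x → ∀ v → proj₁ (from (to x)) v ≈ proj₁ x v

-- finiteness of an abelian group (its carrier is enumerated by some Fin n)
FiniteGroup : ∀ {c ℓ} → AbelianGroup c ℓ → Set (c ⊔ ℓ)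
FiniteGroup G = ∃[ n ] Σ (Fin n → Carrier) λ f → ∀ x → ∃[ i ] f i ≈ x
  where open AbelianGroup G

-- Along a walk from a to b the signed sum of δg telescopes to g(a) − (sign of the walk)·g(b).
-- The multiplicities of a circuit walk give it sign +: a balanced cycle, two unbalanced
-- cycles, and path edges used twice.  Hence δg is a tension.
--
-- An element g of ker δ satisfies g(b) = (sign of the walk)·g(a) along every walk, so it is
-- determined on each component by its value at the least vertex.  That value is arbitrary if
-- the component is balanced and has order two otherwise: an unbalanced closed walk, shortened
-- by cutting off sub-loops, contains an unbalanced cycle.  Conversely, on a balanced component
-- every closed walk is positive, so the sign of a walk from the representative to v is a
-- consistent potential, and multiplying the prescribed value by it gives an element of ker δ.

module Submission where

open import Defs
open import Algebra.Bundles using (AbelianGroup)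
open import Data.Bool using (Bool; true; false; not)
import Data.Bool.Properties as Boolₚ
open import Data.Fin as Fin using (Fin; zero; suc)
import Data.Fin.Properties as Finₚ
open import Data.List using (List; []; _∷_; length; lookup)
open import Data.List.Membership.Propositional using (_∈_)
open import Data.List.Membership.Propositional.Properties using (∈-lookup)
open import Data.List.Relation.Unary.All as All using ()
open import Data.List.Relation.Unary.All.Properties using (¬Any⇒All¬)
open import Data.List.Relation.Unary.AllPairs using ([]; _∷_)
open import Data.List.Relation.Unary.Any using (here; there; any?)
open import Data.List.Relation.Unary.Unique.Propositional using (Unique)
open import Data.Nat as ℕ using (ℕ; zero; suc; _+_; _≤_; _<_; z≤n; s≤s)
import Data.Nat.Properties as ℕₚ
open import Data.Nat.Induction using (<-wellFounded)
open import Data.Product using (Σ; _×_; _,_; proj₁; proj₂)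
open import Data.Sign using (Sign; opposite) renaming (_*_ to _·_)
import Data.Sign.Properties as Signₚ
open import Data.Sum using (_⊎_; inj₁; inj₂)
open import Data.Vec.Functional using (removeAt)
open import Function using (_∘_)
open import Induction.WellFounded using (Acc; acc)
open import Relation.Binary.PropositionalEquality
  using (_≡_; _≢_; refl; sym; trans; cong; cong₂; subst; subst₂; module ≡-Reasoning)
open import Relation.Nullary using (¬_; ¬?; Dec; yes; no; contradiction; _×-dec_; _⊎-dec_)
open import Relation.Nullary.Decidable using (decidable-stable)
open import Relation.Unary using (Pred; Decidable)
open import Algebra.Properties.CommutativeMonoid.Sum Signₚ.*-commutativeMonoid
  using (sum-remove; ∑-distrib-+; sum-cong-≗; sum-replicate-zero) renaming (sum to ∏)
open import Algebra.Properties.Monoid.Mult Signₚ.*-monoid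
  using (×-homo-+; ×-assocˡ) renaming (_×_ to _×ₛ_)

·-swap : ∀ a b c → a · (b · c) ≡ b · (a · c)
·-swap Sign.+ b c = refl
·-swap Sign.- Sign.+ c = refl
·-swap Sign.- Sign.- c = refl

·-involutive : ∀ a b → a · (a · b) ≡ b
·-involutive a b = trans (sym (Signₚ.*-assoc a a b)) (cong (_· b) (Signₚ.s*s≡+ a))

·-move : ∀ s {a b} → a ≡ s · b → b ≡ s · a
·-move s {b = b} refl = sym (·-involutive s b)

·≡+⇒≡ : ∀ {a b} → a · b ≡ Sign.+ → b ≡ a
·≡+⇒≡ {a} {b} ab≡+ = trans (sym (·-involutive a b)) (trans (cong (a ·_) ab≡+) (Signₚ.*-identityʳ a))

≢+⇒≡- : ∀ {s} → s ≢ Sign.+ → s ≡ Sign.-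
≢+⇒≡- {Sign.-} _   = refl
≢+⇒≡- {Sign.+} s≢+ = contradiction refl s≢+

least : ∀ {n p} {P : Pred (Fin n) p} → Decidable P → ∀ {x} → P x →
        Σ (Fin n) λ y → P y × (∀ {z} → P z → y Fin.≤ z)
least {suc n} P? {x} px with P? zero | x
... | yes p₀ | _     = zero , p₀ , λ _ → z≤n
... | no ¬p₀ | zero  = contradiction px ¬p₀
... | no ¬p₀ | suc x with least (λ i → P? (suc i)) px
...   | y , py , min = suc y , py , λ { {zero} pz → contradiction pz ¬p₀ ; {suc z} pz → s≤s (min pz) }

Unique⇒length≤ : ∀ {n} {xs : List (Fin n)} → Unique xs → length xs ≤ n
Unique⇒length≤ {n} {xs} uniq with length xs ℕ.≤? n
... | yes ≤n = ≤n
... | no  >n with Finₚ.pigeonhole (ℕₚ.≰⇒> >n) (lookup xs)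
...   | i , j , i<j , same = contradiction same (distinct uniq i j i<j)
  where
  distinct : ∀ {ys : List (Fin n)} → Unique ys → ∀ i j → i Fin.< j → lookup ys i ≢ lookup ys j
  distinct (y∉ ∷ _) zero    (suc j) _         = All.lookup y∉ (∈-lookup j)
  distinct (_ ∷ u)  (suc i) (suc j) (s≤s i<j) = distinct u i j i<j

∏-single : ∀ {n} (f : Fin n → Sign) i → (∀ j → j ≢ i → f j ≡ Sign.+) → ∏ f ≡ f i
∏-single {suc n} f i others = begin
  ∏ f                      ≡⟨ sum-remove f ⟩
  f i · ∏ (removeAt f i)   ≡⟨ cong (f i ·_) (trans (sum-cong-≗ λ j → others _ (Finₚ.punchInᵢ≢i i j))
                                                  (sum-replicate-zero n)) ⟩
  f i · Sign.+             ≡⟨ Signₚ.*-identityʳ (f i) ⟩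
  f i                      ∎
  where open ≡-Reasoning

module Walks (Γ : SignedGraph) where
  open SignedGraph Γ

  len : ∀ {a b} → Walk Γ a b → ℕ
  len w = length (edges Γ w)

  infixr 5 _++ʷ_
  _++ʷ_ : ∀ {a b c} → Walk Γ a b → Walk Γ b c → Walk Γ a c
  []               ++ʷ q = q
  step e b eq rest ++ʷ q = step e b eq (rest ++ʷ q)

  len-++ʷ : ∀ {a b c} (p : Walk Γ a b) (q : Walk Γ b c) → len (p ++ʷ q) ≡ len p + len q
  len-++ʷ []               q = refl
  len-++ʷ (step e b _ rest) q = cong suc (len-++ʷ rest q)

  signW-++ʷ : ∀ {a b c} (p : Walk Γ a b) (q : Walk Γ b c) →
              signW Γ (p ++ʷ q) ≡ signW Γ p · signW Γ q
  signW-++ʷ []               q = refl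
  signW-++ʷ (step e b _ rest) q =
    trans (cong (σ e ·_) (signW-++ʷ rest q)) (sym (Signₚ.*-assoc (σ e) _ _))

  stepBack : ∀ e b → Walk Γ (end e (not b)) (end e b)
  stepBack e false = step e true refl []
  stepBack e true  = step e false refl []

  signW-stepBack : ∀ e b → signW Γ (stepBack e b) ≡ σ e
  signW-stepBack e false = Signₚ.*-identityʳ (σ e)
  signW-stepBack e true  = Signₚ.*-identityʳ (σ e)

  reverse : ∀ {a b} → Walk Γ a b → Walk Γ b a
  reverse []                   = []
  reverse (step e b refl rest) = reverse rest ++ʷ stepBack e b

  signW-reverse : ∀ {a b} (w : Walk Γ a b) → signW Γ (reverse w) ≡ signW Γ w
  signW-reverse []                   = refl
  signW-reverse (step e b refl rest) = begin
    signW Γ (reverse rest ++ʷ stepBack e b)       ≡⟨ signW-++ʷ (reverse rest) (stepBack e b) ⟩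
    signW Γ (reverse rest) · signW Γ (stepBack e b) ≡⟨ cong₂ _·_ (signW-reverse rest) (signW-stepBack e b) ⟩
    signW Γ rest · σ e                             ≡⟨ Signₚ.*-comm (signW Γ rest) (σ e) ⟩
    σ e · signW Γ rest                             ∎
    where open ≡-Reasoning

  signW-subst : ∀ {a b b′} (eq : b ≡ b′) (w : Walk Γ a b) → signW Γ (subst (Walk Γ a) eq w) ≡ signW Γ w
  signW-subst refl w = refl

  length-verts : ∀ {a b} (w : Walk Γ a b) → length (verts Γ w) ≡ len w
  length-verts []               = refl
  length-verts (step _ _ _ rest) = cong suc (length-verts rest)

  splitAtVertex : ∀ {a c x} (w : Walk Γ a c) → x ∈ verts Γ w →
                  Σ (Walk Γ a x) λ p → Σ (Walk Γ x c) λ r → w ≡ p ++ʷ r × 1 ≤ len r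
  splitAtVertex (step e b eq rest) (here refl) = [] , step e b eq rest , refl , s≤s z≤n
  splitAtVertex (step e b eq rest) (there x∈) with splitAtVertex rest x∈
  ... | p , r , refl , r≢[] = step e b eq p , r , refl , r≢[]

  splitAtEdge : ∀ {a c e} (w : Walk Γ a c) → e ∈ edges Γ w →
                Σ Bool λ b → Σ (Walk Γ a (end e b)) λ p → Σ (Walk Γ (end e (not b)) c) λ r →
                w ≡ p ++ʷ step e b refl r
  splitAtEdge (step e b refl rest) (here refl) = b , [] , rest , refl
  splitAtEdge (step e b eq rest)   (there e∈) with splitAtEdge rest e∈
  ... | b′ , p , r , refl = b′ , step e b eq p , r , refl

  record Reduction {s t} (w : Walk Γ s t) : Set where
    field
      base              : Fin nV
      prefix            : Walk Γ s base
      loop              : Walk Γ base base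
      remainder         : Walk Γ s t
      signW-split       : signW Γ w ≡ signW Γ loop · signW Γ remainder
      loop-shorter      : len loop < len w
      remainder-shorter : len remainder < len w

  len-step-++ʷ : ∀ {t} e b {x} (q : Walk Γ (end e (not b)) x) (r : Walk Γ x t) →
                 len (step e b refl (q ++ʷ r)) ≡ suc (len q + len r)
  len-step-++ʷ e b q r = cong suc (len-++ʷ q r)

  loopAtVertex : ∀ {t} e b (q : Walk Γ (end e (not b)) (end e b)) (r : Walk Γ (end e b) t) →
                 1 ≤ len r → Reduction (step e b refl (q ++ʷ r))
  loopAtVertex e b q r r≢[] = record
    { base = end e b ; prefix = [] ; loop = step e b refl q ; remainder = r
    ; signW-split = trans (cong (σ e ·_) (signW-++ʷ q r)) (sym (Signₚ.*-assoc (σ e) _ _))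
    ; loop-shorter = subst (len (step e b refl q) <_) (sym (len-step-++ʷ e b q r))
                       (s≤s (ℕₚ.m<m+n (len q) r≢[]))
    ; remainder-shorter = subst (len r <_) (sym (len-step-++ʷ e b q r))
                            (s≤s (ℕₚ.m≤n+m (len r) (len q)))
    }

  loopAtEdgeSameWay : ∀ {t} e b (q : Walk Γ (end e (not b)) (end e b)) (r : Walk Γ (end e (not b)) t) →
                      Reduction (step e b refl (q ++ʷ step e b refl r))
  loopAtEdgeSameWay e b q r = record
    { base = end e b ; prefix = [] ; loop = step e b refl q ; remainder = step e b refl r
    ; signW-split = trans (cong (σ e ·_) (signW-++ʷ q (step e b refl r)))
                          (sym (Signₚ.*-assoc (σ e) _ _))
    ; loop-shorter = subst (len (step e b refl q) <_) (sym (len-step-++ʷ e b q (step e b refl r)))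
                       (s≤s (ℕₚ.m<m+n (len q) (s≤s z≤n)))
    ; remainder-shorter = subst (len (step e b refl r) <_) (sym (len-step-++ʷ e b q (step e b refl r)))
                            (s≤s (ℕₚ.m≤n+m (suc (len r)) (len q)))
    }

  castNotNot : ∀ {t} e b → Walk Γ (end e (not (not b))) t → Walk Γ (end e b) t
  castNotNot e false r = r
  castNotNot e true  r = r

  signW-castNotNot : ∀ {t} e b (r : Walk Γ (end e (not (not b))) t) → signW Γ (castNotNot e b r) ≡ signW Γ r
  signW-castNotNot e false r = refl
  signW-castNotNot e true  r = refl

  len-castNotNot : ∀ {t} e b (r : Walk Γ (end e (not (not b))) t) → len (castNotNot e b r) ≡ len r
  len-castNotNot e false r = refl
  len-castNotNot e true  r = refl

  loopAtEdgeBackwards : ∀ {t} e b (q : Walk Γ (end e (not b)) (end e (not b)))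
                        (r : Walk Γ (end e (not (not b))) t) →
                        Reduction (step e b refl (q ++ʷ step e (not b) refl r))
  loopAtEdgeBackwards e b q r = record
    { base = end e (not b) ; prefix = step e b refl [] ; loop = q ; remainder = castNotNot e b r
    ; signW-split = begin
        σ e · signW Γ (q ++ʷ step e (not b) refl r) ≡⟨ cong (σ e ·_) (signW-++ʷ q _) ⟩
        σ e · (signW Γ q · (σ e · signW Γ r))      ≡⟨ ·-swap (σ e) (signW Γ q) _ ⟩
        signW Γ q · (σ e · (σ e · signW Γ r))      ≡⟨ cong (signW Γ q ·_) (·-involutive (σ e) _) ⟩
        signW Γ q · signW Γ r                      ≡⟨ cong (signW Γ q ·_) (sym (signW-castNotNot e b r)) ⟩
        signW Γ q · signW Γ (castNotNot e b r)     ∎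
    ; loop-shorter = subst (len q <_) (sym (len-step-++ʷ e b q (step e (not b) refl r)))
                       (ℕₚ.m<n⇒m<1+n (ℕₚ.m<m+n (len q) (s≤s z≤n)))
    ; remainder-shorter = subst₂ _<_ (sym (len-castNotNot e b r))
                                     (sym (len-step-++ʷ e b q (step e (not b) refl r)))
                            (s≤s (ℕₚ.m≤n⇒m≤o+n (len q) (ℕₚ.n≤1+n (len r))))
    }
    where open ≡-Reasoning

  reductionAfterStep : ∀ {t} e b {rest : Walk Γ (end e (not b)) t} →
                       Reduction rest → Reduction (step e b refl rest)
  reductionAfterStep e b R = record
    { base = base ; prefix = step e b refl prefix ; loop = loop ; remainder = step e b refl remainder
    ; signW-split = trans (cong (σ e ·_) signW-split) (·-swap (σ e) (signW Γ loop) _)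
    ; loop-shorter = ℕₚ.m<n⇒m<1+n loop-shorter
    ; remainder-shorter = s≤s remainder-shorter
    }
    where open Reduction R

  reduce : ∀ {s t} (w : Walk Γ s t) → (Unique (verts Γ w) × Unique (edges Γ w)) ⊎ Reduction w
  reduce [] = inj₁ ([] , [])
  reduce (step e b refl rest) with any? (end e b Fin.≟_) (verts Γ rest) | any? (e Fin.≟_) (edges Γ rest)
  ... | yes v∈ | _ with splitAtVertex rest v∈
  ...   | q , r , refl , r≢[] = inj₂ (loopAtVertex e b q r r≢[])
  reduce (step e b refl rest) | no v∉ | yes e∈ with splitAtEdge rest e∈
  ...   | b′ , q , r , refl with b′ Boolₚ.≟ b
  ...     | yes refl = inj₂ (loopAtEdgeSameWay e b q r)
  ...     | no b′≢b with Boolₚ.¬-not b′≢b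
  ...       | refl = inj₂ (loopAtEdgeBackwards e b q r)
  reduce (step e b refl rest) | no v∉ | no e∉ with reduce rest
  ...   | inj₁ (uv , ue) = inj₁ (¬Any⇒All¬ _ v∉ ∷ uv , ¬Any⇒All¬ _ e∉ ∷ ue)
  ...   | inj₂ R         = inj₂ (reductionAfterStep e b R)

  open Reduction

  unbalancedComp-prefix : ∀ {x y} → Walk Γ x y → UnbalancedComp Γ y → UnbalancedComp Γ x
  unbalancedComp-prefix p (u , c , y→u , cycle , unb) = u , c , p ++ʷ y→u , cycle , unb

  closedWalk-unbalanced : ∀ {s} (w : Walk Γ s s) → Unbalanced Γ w → UnbalancedComp Γ s
  closedWalk-unbalanced w = go w (<-wellFounded (len w))
    where
    go : ∀ {s} (w : Walk Γ s s) → Acc _<_ (len w) → Unbalanced Γ w → UnbalancedComp Γ s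
    go [] _ unb = contradiction refl unb
    go w@(step _ _ _ _) (acc shorter) unb with reduce w
    ... | inj₁ (uv , ue) = _ , w , [] , (s≤s z≤n , ue , uv) , unb
    ... | inj₂ R with signW Γ (loop R) Signₚ.≟ Sign.+
    ...   | no loop-unb = unbalancedComp-prefix (prefix R) (go (loop R) (shorter (loop-shorter R)) loop-unb)
    ...   | yes loop-bal = go (remainder R) (shorter (remainder-shorter R))
                              λ rem-bal → unb (trans (signW-split R) (cong₂ _·_ loop-bal rem-bal))

  removeLoops : ∀ {a b} (w : Walk Γ a b) → Σ (Walk Γ a b) λ p → Unique (verts Γ p)
  removeLoops w = go w (<-wellFounded (len w))
    where
    go : ∀ {a b} (w : Walk Γ a b) → Acc _<_ (len w) → Σ (Walk Γ a b) λ p → Unique (verts Γ p)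
    go w (acc shorter) with reduce w
    ... | inj₁ (uv , _) = w , uv
    ... | inj₂ R        = go (remainder R) (shorter (remainder-shorter R))

  len≤nV : ∀ {a b} (w : Walk Γ a b) → Unique (verts Γ w) → len w ≤ nV
  len≤nV w uniq = subst (_≤ nV) (length-verts w) (Unique⇒length≤ uniq)

  BoundedWalk : ℕ → Fin nV → Fin nV → Set
  BoundedWalk k a b = Σ (Walk Γ a b) λ w → len w ≤ k

  boundedWalk? : ∀ k a b → Dec (BoundedWalk k a b)
  boundedWalk? k a b with a Fin.≟ b
  ... | yes refl = yes ([] , z≤n)
  boundedWalk? zero a b | no a≢b = no λ { ([] , _) → a≢b refl ; (step _ _ _ _ , ()) }
  boundedWalk? (suc k) a b | no a≢b
    with Finₚ.any? (λ e → ((end e false Fin.≟ a) ×-dec boundedWalk? k (end e true) b)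
                    ⊎-dec ((end e true Fin.≟ a) ×-dec boundedWalk? k (end e false) b))
  ... | yes (e , inj₁ (refl , w , ≤k)) = yes (step e false refl w , s≤s ≤k)
  ... | yes (e , inj₂ (refl , w , ≤k)) = yes (step e true refl w , s≤s ≤k)
  ... | no none = no λ
    { ([] , _)                     → a≢b refl
    ; (step e false eq w , s≤s ≤k) → none (e , inj₁ (eq , w , ≤k))
    ; (step e true eq w , s≤s ≤k)  → none (e , inj₂ (eq , w , ≤k))
    }

  walk? : ∀ a b → Dec (Walk Γ a b)
  walk? a b with boundedWalk? nV a b
  ... | yes (w , _) = yes w
  ... | no  none    = no λ w → let p , uniq = removeLoops w in none (p , len≤nV p uniq)

  BalancedComp⇒¬UnbalancedComp : ∀ {v} → BalancedComp Γ v → ¬ UnbalancedComp Γ v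
  BalancedComp⇒¬UnbalancedComp bal (u , c , v→u , cycle , unb) = unb (bal u c v→u cycle)

  balancedComp-closedWalk : ∀ {s} → BalancedComp Γ s → (w : Walk Γ s s) → Balanced Γ w
  balancedComp-closedWalk bal w with signW Γ w Signₚ.≟ Sign.+
  ... | yes w-bal = w-bal
  ... | no  w-unb = contradiction (closedWalk-unbalanced w w-unb) (BalancedComp⇒¬UnbalancedComp bal)

module Components (Γ : SignedGraph) where
  open SignedGraph Γ
  open Walks Γ

  private
    leastSource : ∀ v → Σ (Fin nV) λ r → Walk Γ r v × (∀ {u} → Walk Γ u v → r Fin.≤ u)
    leastSource v = least (λ u → walk? u v) []

  rep : Fin nV → Fin nV
  rep v = proj₁ (leastSource v)

  repWalk : ∀ v → Walk Γ (rep v) v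
  repWalk v = proj₁ (proj₂ (leastSource v))

  rep-minimal : ∀ {u v} → Walk Γ u v → rep v Fin.≤ u
  rep-minimal {v = v} = proj₂ (proj₂ (leastSource v))

  rep-walk : ∀ {a b} → Walk Γ a b → rep a ≡ rep b
  rep-walk {a} {b} w = Finₚ.≤-antisym (rep-minimal (repWalk b ++ʷ reverse w)) (rep-minimal (repWalk a ++ʷ w))

  rep-isRep : ∀ v → IsRep Γ (rep v)
  rep-isRep v u w = subst (Fin._≤ u) (sym (rep-walk (reverse (repWalk v) ++ʷ w))) (rep-minimal [])

  isRep⇒rep≡ : ∀ {r} → IsRep Γ r → rep r ≡ r
  isRep⇒rep≡ {r} isRep = Finₚ.≤-antisym (rep-minimal []) (isRep (rep r) (reverse (repWalk r)))

  rep-ends : ∀ e b → rep (end e false) ≡ rep (end e b)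
  rep-ends e false = refl
  rep-ends e true  = rep-walk (step e false refl [])

  potential : Fin nV → Sign
  potential v = signW Γ (repWalk v)

  Consistent : Fin nE → Set
  Consistent e = potential (end e true) ≡ σ e · potential (end e false)

  consistent-step : ∀ {e} → Consistent e → ∀ b → potential (end e (not b)) ≡ σ e · potential (end e b)
  consistent-step cons false = cons
  consistent-step {e} cons true = ·-move (σ e) cons

  potential-walk : ∀ {r} → (∀ e → rep (end e false) ≡ rep r → Consistent e) →
                   ∀ {x y} (q : Walk Γ x y) → rep x ≡ rep r → potential y ≡ potential x · signW Γ q
  potential-walk cons []                   _ = sym (Signₚ.*-identityʳ _)
  potential-walk cons (step e b refl rest) x∼r = begin
    potential _
      ≡⟨ potential-walk cons rest (trans (sym (rep-walk (step e b refl []))) x∼r) ⟩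
    potential (end e (not b)) · signW Γ rest
      ≡⟨ cong (_· signW Γ rest) (consistent-step (cons e e∼r) b) ⟩
    (σ e · potential (end e b)) · signW Γ rest
      ≡⟨ Signₚ.*-assoc (σ e) _ _ ⟩
    σ e · (potential (end e b) · signW Γ rest)
      ≡⟨ ·-swap (σ e) (potential (end e b)) (signW Γ rest) ⟩
    potential (end e b) · (σ e · signW Γ rest)
      ∎
    where
    open ≡-Reasoning
    e∼r : rep (end e false) ≡ rep _
    e∼r = trans (rep-ends e b) x∼r

  consistent? : ∀ e → Dec (Consistent e)
  consistent? e = potential (end e true) Signₚ.≟ σ e · potential (end e false)

  edgeLoop : ∀ e → Walk Γ (rep (end e false)) (rep (end e false))
  edgeLoop e = subst (Walk Γ _) (sym (rep-ends e true))
                 (repWalk (end e false) ++ʷ step e false refl (reverse (repWalk (end e true))))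

  signW-edgeLoop : ∀ e → signW Γ (edgeLoop e) ≡ potential (end e false) · (σ e · potential (end e true))
  signW-edgeLoop e = begin
    signW Γ (edgeLoop e)                       ≡⟨ signW-subst (sym (rep-ends e true)) (repWalk f ++ʷ back) ⟩
    signW Γ (repWalk f ++ʷ back)               ≡⟨ signW-++ʷ (repWalk f) back ⟩
    potential f · (σ e · signW Γ (reverse (repWalk t)))
                                               ≡⟨ cong (λ s → potential f · (σ e · s)) (signW-reverse (repWalk t)) ⟩
    potential f · (σ e · potential t)          ∎
    where
    open ≡-Reasoning
    f t : Fin nV
    f = end e false
    t = end e true
    back : Walk Γ f (rep t)
    back = step e false refl (reverse (repWalk t))

  edgeLoop-balanced⇒consistent : ∀ e → Balanced Γ (edgeLoop e) → Consistent e
  edgeLoop-balanced⇒consistent e bal =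
    ·-move (σ e) (sym (·≡+⇒≡ (trans (sym (signW-edgeLoop e)) bal)))

  balanced⇒consistent : ∀ e → BalancedComp Γ (rep (end e false)) → Consistent e
  balanced⇒consistent e bal = edgeLoop-balanced⇒consistent e (balancedComp-closedWalk bal (edgeLoop e))

  consistent⇒balanced : ∀ r → (∀ e → rep (end e false) ≡ rep r → Consistent e) → BalancedComp Γ r
  consistent⇒balanced r cons u c r→u _ =
    Signₚ.*-cancelˡ-≡ (potential u) _ _
      (trans (sym (potential-walk cons c (sym (rep-walk r→u)))) (sym (Signₚ.*-identityʳ (potential u))))

  classify : ∀ r → BalancedComp Γ r ⊎ UnbalancedComp Γ r
  classify r with Finₚ.any? (λ e → (rep (end e false) Fin.≟ rep r) ×-dec ¬? (consistent? e))
  ... | yes (e , e∼r , ¬cons) =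
    inj₂ (unbalancedComp-prefix (subst (Walk Γ r) (sym e∼r) (reverse (repWalk r)))
            (closedWalk-unbalanced (edgeLoop e) (¬cons ∘ edgeLoop-balanced⇒consistent e)))
  ... | no none = inj₁ (consistent⇒balanced r λ e e∼r →
                          decidable-stable (consistent? e) λ ¬cons → none (e , e∼r , ¬cons))

  potential-rep : ∀ {r} → IsRep Γ r → BalancedComp Γ r → potential r ≡ Sign.+
  potential-rep {r} isRep bal =
    trans (sym (signW-subst r≡rep (repWalk r)))
          (balancedComp-closedWalk (subst (BalancedComp Γ) r≡rep bal)
                                   (subst (Walk Γ (rep r)) r≡rep (repWalk r)))
    where
    r≡rep : r ≡ rep r
    r≡rep = sym (isRep⇒rep≡ isRep)

module CircuitSigns (Γ : SignedGraph) where
  open SignedGraph Γ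

  multiplicity : ∀ {a b} → Walk Γ a b → Fin nE → ℕ
  multiplicity w e = occ Γ e (edges Γ w)

  signOf : (Fin nE → ℕ) → Sign
  signOf m = ∏ λ e → m e ×ₛ σ e

  signOf-+ : ∀ (m m′ : Fin nE → ℕ) → signOf (λ e → m e + m′ e) ≡ signOf m · signOf m′
  signOf-+ m m′ = trans (sum-cong-≗ λ e → ×-homo-+ (σ e) (m e) (m′ e))
                        (∑-distrib-+ (λ e → m e ×ₛ σ e) (λ e → m′ e ×ₛ σ e))

  signOf-2* : ∀ (m : Fin nE → ℕ) → signOf (λ e → 2 ℕ.* m e) ≡ Sign.+
  signOf-2* m = trans (sum-cong-≗ even) (sum-replicate-zero nE)
    where
    square : ∀ s → s · (s · Sign.+) ≡ Sign.+
    square s = trans (cong (s ·_) (Signₚ.*-identityʳ s)) (Signₚ.s*s≡+ s)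
    even : ∀ e → (2 ℕ.* m e) ×ₛ σ e ≡ Sign.+
    even e = trans (sym (×-assocˡ (σ e) 2 (m e))) (square (m e ×ₛ σ e))

  onlyAt : Fin nE → Fin nE → Sign
  onlyAt e x with x Fin.≟ e
  ... | yes _ = σ x
  ... | no  _ = Sign.+

  ∏-onlyAt : ∀ e → ∏ (onlyAt e) ≡ σ e
  ∏-onlyAt e = trans (∏-single (onlyAt e) e away) at
    where
    away : ∀ x → x ≢ e → onlyAt e x ≡ Sign.+
    away x x≢e with x Fin.≟ e
    ... | yes x≡e = contradiction x≡e x≢e
    ... | no  _   = refl
    at : onlyAt e e ≡ σ e
    at with e Fin.≟ e
    ... | yes _   = refl
    ... | no  e≢e = contradiction refl e≢e

  occ-∷ : ∀ x e l → occ Γ x (e ∷ l) ×ₛ σ x ≡ onlyAt e x · (occ Γ x l ×ₛ σ x)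
  occ-∷ x e l with x Fin.≟ e
  ... | yes _ = refl
  ... | no  _ = refl

  signW≡signOf-multiplicity : ∀ {a b} (w : Walk Γ a b) → signW Γ w ≡ signOf (multiplicity w)
  signW≡signOf-multiplicity []                = sym (sum-replicate-zero nE)
  signW≡signOf-multiplicity (step e b eq rest) = begin
    σ e · signW Γ rest
      ≡⟨ cong₂ _·_ (sym (∏-onlyAt e)) (signW≡signOf-multiplicity rest) ⟩
    ∏ (onlyAt e) · signOf (multiplicity rest)
      ≡⟨ sym (∑-distrib-+ (onlyAt e) (λ x → multiplicity rest x ×ₛ σ x)) ⟩
    ∏ (λ x → onlyAt e x · (multiplicity rest x ×ₛ σ x))
      ≡⟨ sum-cong-≗ (λ x → sym (occ-∷ x e (edges Γ rest))) ⟩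
    signOf (multiplicity (step e b eq rest))
      ∎
    where open ≡-Reasoning

  handcuff-balanced : ∀ {u v} (c₁ : Walk Γ u u) (c₂ : Walk Γ v v) → Unbalanced Γ c₁ → Unbalanced Γ c₂ →
                      signOf (λ e → multiplicity c₁ e + multiplicity c₂ e) ≡ Sign.+
  handcuff-balanced c₁ c₂ unb₁ unb₂ = begin
    signOf (λ e → multiplicity c₁ e + multiplicity c₂ e)   ≡⟨ signOf-+ (multiplicity c₁) (multiplicity c₂) ⟩
    signOf (multiplicity c₁) · signOf (multiplicity c₂)
      ≡⟨ sym (cong₂ _·_ (signW≡signOf-multiplicity c₁) (signW≡signOf-multiplicity c₂)) ⟩
    signW Γ c₁ · signW Γ c₂                                ≡⟨ cong₂ _·_ (≢+⇒≡- unb₁) (≢+⇒≡- unb₂) ⟩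
    Sign.+                                                 ∎
    where open ≡-Reasoning

  circuit-balanced : ∀ {m} → CircuitMult Γ m → signOf m ≡ Sign.+
  circuit-balanced (balancedCycle c _ bal) = trans (sym (signW≡signOf-multiplicity c)) bal
  circuit-balanced (tightHandcuff c₁ c₂ _ _ unb₁ unb₂ _ _) = handcuff-balanced c₁ c₂ unb₁ unb₂
  circuit-balanced (looseHandcuff c₁ c₂ p _ _ unb₁ unb₂ _ _ _ _ _ _) =
    trans (signOf-+ (λ e → multiplicity c₁ e + multiplicity c₂ e) (λ e → 2 ℕ.* multiplicity p e))
          (cong₂ _·_ (handcuff-balanced c₁ c₂ unb₁ unb₂) (signOf-2* (multiplicity p)))

  circuitWalk-balanced : ∀ {u} (w : Walk Γ u u) → IsCircuitWalk Γ w → Balanced Γ w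
  circuitWalk-balanced w (m , circuit , counts) =
    trans (signW≡signOf-multiplicity w)
          (trans (sum-cong-≗ λ e → cong (_×ₛ σ e) (counts e)) (circuit-balanced circuit))

module Tensions (Γ : SignedGraph) {c ℓ} (G : AbelianGroup c ℓ) where
  open SignedGraph Γ
  open AbelianGroup G renaming (refl to ≈-refl; sym to ≈-sym; trans to ≈-trans)
  open import Algebra.Properties.AbelianGroup G
    using (⁻¹-∙-comm; inverseˡ-unique; x∙y⁻¹≈ε⇒x≈y; x≈y⇒x∙y⁻¹≈ε; ⁻¹-involutive; ε⁻¹≈ε)
  open import Algebra.Properties.Monoid monoid using (cancelᶜ)
  open import Algebra.Properties.CommutativeSemigroup commutativeSemigroup using (interchange)
  open import Relation.Binary.Reasoning.Setoid setoid
  open Walks Γ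
  open Components Γ
  open CircuitSigns Γ

  infixr 8 _⊙_
  _⊙_ : Sign → Carrier → Carrier
  _⊙_ = act Γ G

  ⊙-cong : ∀ s {x y} → x ≈ y → s ⊙ x ≈ s ⊙ y
  ⊙-cong Sign.+ x≈y = x≈y
  ⊙-cong Sign.- x≈y = ⁻¹-cong x≈y

  ⊙-congˡ : ∀ {s t} x → s ≡ t → s ⊙ x ≈ t ⊙ x
  ⊙-congˡ x refl = ≈-refl

  ⊙-distrib-∙ : ∀ s x y → s ⊙ (x ∙ y) ≈ s ⊙ x ∙ s ⊙ y
  ⊙-distrib-∙ Sign.+ x y = ≈-refl
  ⊙-distrib-∙ Sign.- x y = ≈-sym (⁻¹-∙-comm x y)

  ⊙-⁻¹ : ∀ s x → s ⊙ (x ⁻¹) ≈ (s ⊙ x) ⁻¹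
  ⊙-⁻¹ Sign.+ x = ≈-refl
  ⊙-⁻¹ Sign.- x = ≈-refl

  ⊙-assoc : ∀ s t x → s ⊙ t ⊙ x ≈ (s · t) ⊙ x
  ⊙-assoc Sign.+ t      x = ≈-refl
  ⊙-assoc Sign.- Sign.+ x = ≈-refl
  ⊙-assoc Sign.- Sign.- x = ⁻¹-involutive x

  ⊙-opposite : ∀ s x → opposite s ⊙ x ≈ (s ⊙ x) ⁻¹
  ⊙-opposite Sign.+ x = ≈-refl
  ⊙-opposite Sign.- x = ≈-sym (⁻¹-involutive x)

  ⊙-ε : ∀ s → s ⊙ ε ≈ ε
  ⊙-ε Sign.+ = ≈-refl
  ⊙-ε Sign.- = ε⁻¹≈ε

  ⊙-involutive : ∀ s x → s ⊙ s ⊙ x ≈ x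
  ⊙-involutive s x = ≈-trans (⊙-assoc s s x) (⊙-congˡ x (Signₚ.s*s≡+ s))

  ⊙-order2 : ∀ s {x} → x ∙ x ≈ ε → s ⊙ x ≈ x
  ⊙-order2 Sign.+ _     = ≈-refl
  ⊙-order2 Sign.- x∙x≈ε = ≈-sym (inverseˡ-unique _ _ x∙x≈ε)

  module _ (ω : Orientation Γ) (compat : Compatible Γ ω) where

    ω-product : ∀ e b → ω e b · ω e (not b) ≡ opposite (σ e)
    ω-product e false = sym (trans (cong opposite (compat e)) (Signₚ.opposite-involutive _))
    ω-product e true  = trans (Signₚ.*-comm (ω e true) (ω e false)) (ω-product e false)

    δ-split : ∀ g e b → δ Γ G ω g e ≈ ω e b ⊙ g (end e b) ∙ ω e (not b) ⊙ g (end e (not b))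
    δ-split g e true  = ≈-refl
    δ-split g e false = comm _ _

    δ-halfEdge : ∀ g e b → ω e b ⊙ δ Γ G ω g e ≈ g (end e b) ∙ (σ e ⊙ g (end e (not b))) ⁻¹
    δ-halfEdge g e b = begin
      x ⊙ δ Γ G ω g e              ≈⟨ ⊙-cong x (δ-split g e b) ⟩
      x ⊙ (x ⊙ A ∙ y ⊙ B)          ≈⟨ ⊙-distrib-∙ x _ _ ⟩
      x ⊙ x ⊙ A ∙ x ⊙ y ⊙ B        ≈⟨ ∙-cong (⊙-involutive x A) (⊙-assoc x y B) ⟩
      A ∙ (x · y) ⊙ B              ≈⟨ ∙-congˡ (⊙-congˡ B (ω-product e b)) ⟩
      A ∙ opposite (σ e) ⊙ B       ≈⟨ ∙-congˡ (⊙-opposite (σ e) B) ⟩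
      A ∙ (σ e ⊙ B) ⁻¹             ∎
      where
      x y : Sign
      x = ω e b
      y = ω e (not b)
      A B : Carrier
      A = g (end e b)
      B = g (end e (not b))

    δ-homomorphism : IsHomδ Γ G ω
    δ-homomorphism g h e =
      ≈-trans (∙-cong (⊙-distrib-∙ (ω e true) _ _) (⊙-distrib-∙ (ω e false) _ _)) (interchange _ _ _ _)

    tsum-δ : ∀ g s {a b} (w : Walk Γ a b) →
             tsum Γ G ω (δ Γ G ω g) s w ≈ s ⊙ g a ∙ ((s · signW Γ w) ⊙ g b) ⁻¹
    tsum-δ g s {a} [] =
      ≈-sym (≈-trans (∙-congˡ (⁻¹-cong (⊙-congˡ (g a) (Signₚ.*-identityʳ s)))) (inverseʳ _))
    tsum-δ g s {a} {c} (step e b refl rest) = begin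
      (ω e b · s) ⊙ δ Γ G ω g e ∙ tsum Γ G ω (δ Γ G ω g) (s · σ e) rest
        ≈⟨ ∙-cong firstStep (tsum-δ g (s · σ e) rest) ⟩
      (s ⊙ g a ∙ ((s · σ e) ⊙ B) ⁻¹) ∙ ((s · σ e) ⊙ B ∙ (((s · σ e) · signW Γ rest) ⊙ g c) ⁻¹)
        ≈⟨ cancelᶜ (inverseˡ _) _ _ ⟩
      s ⊙ g a ∙ (((s · σ e) · signW Γ rest) ⊙ g c) ⁻¹
        ≈⟨ ∙-congˡ (⁻¹-cong (⊙-congˡ (g c) (Signₚ.*-assoc s (σ e) (signW Γ rest)))) ⟩
      s ⊙ g a ∙ ((s · (σ e · signW Γ rest)) ⊙ g c) ⁻¹ ∎
      where
      B : Carrier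
      B = g (end e (not b))
      firstStep : (ω e b · s) ⊙ δ Γ G ω g e ≈ s ⊙ g a ∙ ((s · σ e) ⊙ B) ⁻¹
      firstStep = begin
        (ω e b · s) ⊙ δ Γ G ω g e        ≈⟨ ⊙-congˡ _ (Signₚ.*-comm (ω e b) s) ⟩
        (s · ω e b) ⊙ δ Γ G ω g e        ≈⟨ ≈-sym (⊙-assoc s (ω e b) _) ⟩
        s ⊙ ω e b ⊙ δ Γ G ω g e          ≈⟨ ⊙-cong s (δ-halfEdge g e b) ⟩
        s ⊙ (g a ∙ (σ e ⊙ B) ⁻¹)         ≈⟨ ⊙-distrib-∙ s _ _ ⟩
        s ⊙ g a ∙ s ⊙ ((σ e ⊙ B) ⁻¹)     ≈⟨ ∙-congˡ (⊙-⁻¹ s _) ⟩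
        s ⊙ g a ∙ (s ⊙ σ e ⊙ B) ⁻¹       ≈⟨ ∙-congˡ (⁻¹-cong (⊙-assoc s (σ e) B)) ⟩
        s ⊙ g a ∙ ((s · σ e) ⊙ B) ⁻¹     ∎

    δ-isTension : ∀ g → IsTension Γ G ω (δ Γ G ω g)
    δ-isTension g {u} w circuitWalk = begin
      tsum Γ G ω (δ Γ G ω g) Sign.+ w       ≈⟨ tsum-δ g Sign.+ w ⟩
      g u ∙ (signW Γ w ⊙ g u) ⁻¹
        ≈⟨ ∙-congˡ (⁻¹-cong (⊙-congˡ (g u) (circuitWalk-balanced w circuitWalk))) ⟩
      g u ∙ g u ⁻¹                          ≈⟨ inverseʳ (g u) ⟩
      ε                                     ∎

    δ≈ε⇒edgeRule : ∀ {g e} → δ Γ G ω g e ≈ ε → ∀ b → g (end e (not b)) ≈ σ e ⊙ g (end e b)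
    δ≈ε⇒edgeRule {g} {e} δ≈ε b = begin
      B                  ≈⟨ ≈-sym (⊙-involutive (σ e) B) ⟩
      σ e ⊙ σ e ⊙ B      ≈⟨ ⊙-cong (σ e) (≈-sym (x∙y⁻¹≈ε⇒x≈y A (σ e ⊙ B) A∙B⁻¹≈ε)) ⟩
      σ e ⊙ A            ∎
      where
      A B : Carrier
      A = g (end e b)
      B = g (end e (not b))
      A∙B⁻¹≈ε : A ∙ (σ e ⊙ B) ⁻¹ ≈ ε
      A∙B⁻¹≈ε = ≈-trans (≈-sym (δ-halfEdge g e b)) (≈-trans (⊙-cong (ω e b) δ≈ε) (⊙-ε (ω e b)))

    edgeRule⇒δ≈ε : ∀ {g e} → g (end e true) ≈ σ e ⊙ g (end e false) → δ Γ G ω g e ≈ ε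
    edgeRule⇒δ≈ε {g} {e} rule = begin
      δ Γ G ω g e                                          ≈⟨ ≈-sym (⊙-involutive (ω e true) _) ⟩
      ω e true ⊙ ω e true ⊙ δ Γ G ω g e                    ≈⟨ ⊙-cong (ω e true) (δ-halfEdge g e true) ⟩
      ω e true ⊙ (g (end e true) ∙ (σ e ⊙ g (end e false)) ⁻¹) ≈⟨ ⊙-cong (ω e true) (x≈y⇒x∙y⁻¹≈ε rule) ⟩
      ω e true ⊙ ε                                         ≈⟨ ⊙-ε (ω e true) ⟩
      ε                                                    ∎

    module Kernel (g : Fin nV → Carrier) (g∈ker : ∀ e → δ Γ G ω g e ≈ ε) where

      kernel-transport : ∀ {a b} (w : Walk Γ a b) → g b ≈ signW Γ w ⊙ g a
      kernel-transport []                       = ≈-refl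
      kernel-transport {a} (step e b refl rest) = begin
        g _                                     ≈⟨ kernel-transport rest ⟩
        signW Γ rest ⊙ g (end e (not b))        ≈⟨ ⊙-cong (signW Γ rest) (δ≈ε⇒edgeRule {g} (g∈ker e) b) ⟩
        signW Γ rest ⊙ σ e ⊙ g a                ≈⟨ ⊙-assoc (signW Γ rest) (σ e) (g a) ⟩
        (signW Γ rest · σ e) ⊙ g a              ≈⟨ ⊙-congˡ (g a) (Signₚ.*-comm (signW Γ rest) (σ e)) ⟩
        (σ e · signW Γ rest) ⊙ g a              ∎

      kernel-unbalanced : ∀ {r} → UnbalancedComp Γ r → g r ∙ g r ≈ ε
      kernel-unbalanced {r} (u , c , r→u , _ , unb) = begin
        g r ∙ g r                ≈⟨ ≈-sym (⊙-involutive s _) ⟩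
        s ⊙ s ⊙ (g r ∙ g r)      ≈⟨ ⊙-cong s (⊙-distrib-∙ s (g r) (g r)) ⟩
        s ⊙ (s ⊙ g r ∙ s ⊙ g r)  ≈⟨ ⊙-cong s (∙-cong gu≈ gu≈) ⟩
        s ⊙ (g u ∙ g u)          ≈⟨ ⊙-cong s (≈-trans (∙-congʳ gu≈gu⁻¹) (inverseˡ (g u))) ⟩
        s ⊙ ε                    ≈⟨ ⊙-ε s ⟩
        ε                        ∎
        where
        s : Sign
        s = signW Γ r→u
        gu≈ : s ⊙ g r ≈ g u
        gu≈ = ≈-sym (kernel-transport r→u)
        gu≈gu⁻¹ : g u ≈ g u ⁻¹
        gu≈gu⁻¹ = ≈-trans (kernel-transport c) (⊙-congˡ (g u) (≢+⇒≡- unb))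

    module Isomorphism {kb ku} (kb-count : IsKb Γ kb) (ku-count : IsKu Γ ku) where

      bRep : Fin kb → Fin nV
      bRep = proj₁ kb-count

      bRep-valid : ∀ i → IsRep Γ (bRep i) × BalancedComp Γ (bRep i)
      bRep-valid = proj₁ (proj₂ (proj₂ kb-count))

      bIndex : ∀ {r} → IsRep Γ r → BalancedComp Γ r → Fin kb
      bIndex {r} isRep bal = proj₁ (proj₂ (proj₂ (proj₂ kb-count)) r (isRep , bal))

      bRep-bIndex : ∀ {r} (isRep : IsRep Γ r) (bal : BalancedComp Γ r) → bRep (bIndex isRep bal) ≡ r
      bRep-bIndex {r} isRep bal = proj₂ (proj₂ (proj₂ (proj₂ kb-count)) r (isRep , bal))

      bIndex-unique : ∀ {i r} (isRep : IsRep Γ r) (bal : BalancedComp Γ r) → bRep i ≡ r → bIndex isRep bal ≡ i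
      bIndex-unique {r = r} isRep bal eq =
        proj₁ (proj₂ kb-count) (trans (bRep-bIndex isRep bal) (sym eq))

      uRep : Fin ku → Fin nV
      uRep = proj₁ ku-count

      uRep-valid : ∀ j → IsRep Γ (uRep j) × UnbalancedComp Γ (uRep j)
      uRep-valid = proj₁ (proj₂ (proj₂ ku-count))

      uIndex : ∀ {r} → IsRep Γ r → UnbalancedComp Γ r → Fin ku
      uIndex {r} isRep unb = proj₁ (proj₂ (proj₂ (proj₂ ku-count)) r (isRep , unb))

      uRep-uIndex : ∀ {r} (isRep : IsRep Γ r) (unb : UnbalancedComp Γ r) → uRep (uIndex isRep unb) ≡ r
      uRep-uIndex {r} isRep unb = proj₂ (proj₂ (proj₂ (proj₂ ku-count)) r (isRep , unb))

      uIndex-unique : ∀ {j r} (isRep : IsRep Γ r) (unb : UnbalancedComp Γ r) → uRep j ≡ r → uIndex isRep unb ≡ j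
      uIndex-unique {r = r} isRep unb eq =
        proj₁ (proj₂ ku-count) (trans (uRep-uIndex isRep unb) (sym eq))

      -- The value at a vertex whose walk from the representative r has sign s.
      componentValue : Target Γ G kb ku → (r : Fin nV) → IsRep Γ r → Sign → Carrier
      componentValue (a , b , _) r isRep s with classify r
      ... | inj₁ bal = s ⊙ a (bIndex isRep bal)
      ... | inj₂ unb = b (uIndex isRep unb)

      componentValue-cong : ∀ t t′ → (∀ i → proj₁ t i ≈ proj₁ t′ i) →
                       (∀ j → proj₁ (proj₂ t) j ≈ proj₁ (proj₂ t′) j) →
                       ∀ r isRep s → componentValue t r isRep s ≈ componentValue t′ r isRep s
      componentValue-cong t t′ a≈ b≈ r isRep s with classify r
      ... | inj₁ bal = ⊙-cong s (a≈ _)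
      ... | inj₂ unb = b≈ _

      componentValue-switch : ∀ t {r r′} → r ≡ r′ → (isRep : IsRep Γ r) (isRep′ : IsRep Γ r′) →
                         ∀ s s′ σ′ → (BalancedComp Γ r → s′ ≡ σ′ · s) →
                         componentValue t r′ isRep′ s′ ≈ σ′ ⊙ componentValue t r isRep s
      componentValue-switch (a , b , b-order2) {r} refl isRep isRep′ s s′ σ′ rule with classify r
      ... | inj₁ bal = begin
        s′ ⊙ a (bIndex isRep′ bal)   ≈⟨ ⊙-congˡ _ (rule bal) ⟩
        (σ′ · s) ⊙ a (bIndex isRep′ bal)
          ≡⟨ cong (λ i → (σ′ · s) ⊙ a i) (bIndex-unique isRep′ bal (bRep-bIndex isRep bal)) ⟩
        (σ′ · s) ⊙ a (bIndex isRep bal) ≈⟨ ≈-sym (⊙-assoc σ′ s _) ⟩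
        σ′ ⊙ s ⊙ a (bIndex isRep bal) ∎
      ... | inj₂ unb = begin
        b (uIndex isRep′ unb)   ≡⟨ cong b (uIndex-unique isRep′ unb (uRep-uIndex isRep unb)) ⟩
        b (uIndex isRep unb)    ≈⟨ ≈-sym (⊙-order2 σ′ (b-order2 _)) ⟩
        σ′ ⊙ b (uIndex isRep unb) ∎

      componentValue-balancedRep : ∀ t i {r} (isRep : IsRep Γ r) s → bRep i ≡ r → s ≡ Sign.+ →
                              componentValue t r isRep s ≈ proj₁ t i
      componentValue-balancedRep (a , b , _) i {r} isRep s eq s≡+ with classify r
      ... | inj₁ bal = ≈-trans (⊙-congˡ _ s≡+) (reflexive (cong a (bIndex-unique isRep bal eq)))
      ... | inj₂ unb =
        contradiction unb (BalancedComp⇒¬UnbalancedComp (subst (BalancedComp Γ) eq (proj₂ (bRep-valid i))))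

      componentValue-unbalancedRep : ∀ t j {r} (isRep : IsRep Γ r) s → uRep j ≡ r →
                                componentValue t r isRep s ≈ proj₁ (proj₂ t) j
      componentValue-unbalancedRep (a , b , _) j {r} isRep s eq with classify r
      ... | inj₁ bal =
        contradiction (subst (UnbalancedComp Γ) eq (proj₂ (uRep-valid j))) (BalancedComp⇒¬UnbalancedComp bal)
      ... | inj₂ unb = reflexive (cong b (uIndex-unique isRep unb eq))

      toTarget : Ker Γ G ω → Target Γ G kb ku
      toTarget (g , g∈ker) = (λ i → g (bRep i)) , (λ j → g (uRep j)) ,
                             λ j → Kernel.kernel-unbalanced g g∈ker (proj₂ (uRep-valid j))

      componentValue-kernel : ∀ (x : Ker Γ G ω) {r v} (isRep : IsRep Γ r) (w : Walk Γ r v) →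
                         componentValue (toTarget x) r isRep (signW Γ w) ≈ proj₁ x v
      componentValue-kernel (g , g∈ker) {r} isRep w with classify r
      ... | inj₁ bal = begin
        signW Γ w ⊙ g (bRep (bIndex isRep bal)) ≡⟨ cong (λ v → signW Γ w ⊙ g v) (bRep-bIndex isRep bal) ⟩
        signW Γ w ⊙ g r                          ≈⟨ ≈-sym (kernel-transport w) ⟩
        g _                                      ∎
        where open Kernel g g∈ker
      ... | inj₂ unb = begin
        g (uRep (uIndex isRep unb)) ≡⟨ cong g (uRep-uIndex isRep unb) ⟩
        g r                          ≈⟨ ≈-sym (⊙-order2 (signW Γ w) (kernel-unbalanced unb)) ⟩
        signW Γ w ⊙ g r              ≈⟨ ≈-sym (kernel-transport w) ⟩
        g _                          ∎
        where open Kernel g g∈ker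

      extend : Target Γ G kb ku → Fin nV → Carrier
      extend t v = componentValue t (rep v) (rep-isRep v) (potential v)

      extend-inKer : ∀ t e → δ Γ G ω (extend t) e ≈ ε
      extend-inKer t e = edgeRule⇒δ≈ε {extend t}
        (componentValue-switch t (rep-ends e true) (rep-isRep _) (rep-isRep _) _ _ (σ e) (balanced⇒consistent e))

      extend-balancedRep : ∀ t i → extend t (bRep i) ≈ proj₁ t i
      extend-balancedRep t i = componentValue-balancedRep t i (rep-isRep (bRep i)) _
        (sym (isRep⇒rep≡ isRep)) (potential-rep isRep bal)
        where
        isRep : IsRep Γ (bRep i)
        isRep = proj₁ (bRep-valid i)
        bal : BalancedComp Γ (bRep i)
        bal = proj₂ (bRep-valid i)

      extend-unbalancedRep : ∀ t j → extend t (uRep j) ≈ proj₁ (proj₂ t) j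
      extend-unbalancedRep t j =
        componentValue-unbalancedRep t j (rep-isRep (uRep j)) _ (sym (isRep⇒rep≡ (proj₁ (uRep-valid j))))

      kerIso : KerIso Γ G ω kb ku
      kerIso = record
        { to        = toTarget
        ; from      = λ t → extend t , extend-inKer t
        ; to-cong   = λ _ _ x≈y → (λ i → x≈y (bRep i)) , (λ j → x≈y (uRep j))
        ; from-cong = λ s t a≈ b≈ v → componentValue-cong s t a≈ b≈ (rep v) (rep-isRep v) (potential v)
        ; to-hom    = λ _ _ _ z≈x∙y → (λ i → z≈x∙y (bRep i)) , (λ j → z≈x∙y (uRep j))
        ; to-from   = λ t → extend-balancedRep t , extend-unbalancedRep t
        ; from-to   = λ x v → componentValue-kernel x (rep-isRep v) (repWalk v)
        }

theorem7p13 : ∀ {c ℓ} (G : AbelianGroup c ℓ) → FiniteGroup G →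
    (Γ : SignedGraph) (ω : Orientation Γ) → Compatible Γ ω →
    IsHomδ Γ G ω ×
    (∀ g → IsTension Γ G ω (δ Γ G ω g)) ×
    (∀ kb ku → IsKb Γ kb → IsKu Γ ku → KerIso Γ G ω kb ku)
theorem7p13 G _ Γ ω compat =
  δ-homomorphism ω compat , δ-isTension ω compat ,
  λ kb ku kb-count ku-count → Isomorphism.kerIso ω compat kb-count ku-count
  where open Tensions Γ G
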